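{- Let $\mathcal C$ be an updown category with object generating function $O_{\mathcal C}(t)=\sum_{n\ge 0}a_nt^n$ and morphism generating function $M_{\mathcal C}(t)$. 1. If $\mathcal C$ is evenly up-covered with sequence $u_0,u_1,\dots$, then $M_{\mathcal C}(t)=\sum_{n\ge 0}a_nu_nt^{2n+1}$. 2. If $\mathcal C$ is evenly down-covered with sequence $d_1,d_2,\dots$, then $M_{\mathcal C}(t)=\sum_{n\ge 1}a_nd_nt^{2n-1}$.
   Context: An updown category is a small category $\mathcal C$ with a rank functor $|\cdot|:\mathcal C\to\mathbb N$ (where $\mathbb N=\{0,1,2,\dots\}$ is the ordered set of natural numbers regarded as a category) such that: (A1) each rank $\mathcal C_n=\{p\in\operatorname{Ob}\mathcal C:|p|=n\}$ is finite; (A2) $\mathcal C_0$ consists of a single object $\hat 0$, and $\operatorname{Hom}(\hat 0,p)$ is nonempty for all objects $p$; (A3) for objects $p,p'$, $\operatorname{Hom}(p,p')$ is always finite, and $\operatorname{Hom}(p,p')=\emptyset$ unless $|p|<|p'|$ or $p=p'$; in the latter case $\operatorname{Hom}(p,p)$ is a group, denoted $\operatorname{Aut}(p)$; (A4) any morphism $p\to p'$ with $|p'|=|p|+k$ factors as a composition $p=p_0\to p_1\to\cdots\to p_k=p'$ with $|p_{i+1}|=|p_i|+1$; (A5) if $|p'|=|p|+1$, the actions of $\operatorname{Aut}(p)$ and $\operatorname{Aut}(p')$ on $\operatorname{Hom}(p,p')$ (by precomposition and postcomposition respectively) are free. For objects $p,p'$ with $|p'|=|p|+1$, set $u(p;p')=|\operatorname{Hom}(p,p')|/|\operatorname{Aut}(p')|$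 and $d(p;p')=|\operatorname{Hom}(p,p')|/|\operatorname{Aut}(p)|$. Write $p\lhd q$ (equivalently $q\rhd p$) if $q$ covers $p$ in the partial order on $\operatorname{Ob}\mathcal C$ given by $p\preceq q\iff\operatorname{Hom}(p,q)\ne\emptyset$; equivalently, $|q|=|p|+1$ and $\operatorname{Hom}(p,q)\neq\emptyset$. $\mathcal C$ is evenly up-covered (with sequence $u_0,u_1,\dots$) if $\sum_{q\rhd p}u(p;q)=u_n$ for all $n$ and all $p\in\mathcal C_n$. $\mathcal C$ is evenly down-covered (with sequence $d_1,d_2,\dots$) if $\sum_{q\lhd p}d(q;p)=d_n$ for all $n\ge1$ and all $p\in\mathcal C_n$. The generating functions, elements of $\mathbb Q[[t]]$, are $$O_{\mathcal C}(t)=\sum_{p\in\operatorname{Ob}\mathcal C}\frac{t^{|p|}}{|\operatorname{Aut}(p)|},\qquad M_{\mathcal C}(t)=\sum_{p\lhd q}\frac{u(p;q)\,t^{|p|+|q|}}{|\operatorname{Aut}(p)|}.$$ -}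

module Defs where

open import Algebra.Structures using (IsGroup)
open import Data.Empty using (⊥-elim)
open import Data.Fin.Base using (Fin)
open import Data.Integer.Base using (+_; 1ℤ)
open import Data.List.Base using (List; foldr; map; filter; tabulate; upTo; _++_; cartesianProduct)
open import Data.List.Membership.Propositional using (_∈_)
open import Data.List.Membership.Propositional.Properties
  using (∈-filter⁺; ∈-filter⁻; ∈-tabulate⁺; ∈-tabulate⁻; ∈-++⁺ˡ; ∈-++⁺ʳ; ∈-++⁻; ∈-upTo⁺; ∈-upTo⁻;
         ∈-cartesianProduct⁺; ∈-cartesianProduct⁻)
open import Data.List.Relation.Unary.Unique.Propositional using (Unique)
import Data.List.Relation.Unary.Unique.Propositional.Properties as Unique
open import Data.Nat.Base using (ℕ; zero; suc; _+_; _*_; _∸_; _≤_; _<_; _≥_; z≤n; s≤s; NonZero)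
open import Data.Nat.Properties as ℕ using (_≟_; _≥?_; ≡-irrelevant)
open import Data.Product.Base using (Σ; Σ-syntax; _×_; _,_; ∃; proj₁; proj₂; uncurry)
open import Data.Rational.Base as ℚ using (ℚ; 0ℚ; _/_)
open import Data.Sum.Base using (_⊎_; inj₁; inj₂)
open import Data.Unit.Base using (tt)
open import Function.Base using (case_of_; _$_)
open import Function.Bundles using (_↔_; Inverse)
open import Level using (Level; _⊔_) renaming (suc to lsuc)
open import Relation.Binary.Core using (Rel)
open import Relation.Binary.PropositionalEquality
  using (_≡_; _≢_; refl; sym; trans; cong; subst)
import Relation.Binary.Construct.NonStrictToStrict as ToStrict
open import Relation.Nullary using (¬_; Dec; yes; no)
open import Relation.Nullary.Decidable using (_×-dec_; map′)
open import Relation.Unary using (Pred; Decidable; U)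

private
  variable
    a p q : Level
    A : Set a
    P : Pred A p
    Q : Pred A q

Finite : Set a → Set a
Finite A = ∃ λ n → A ↔ Fin n

card : Finite A → ℕ
card = proj₁

-- Only the elements x for which P x is inhabited are listed, each exactly
-- once: P may be proof-relevant without affecting multiplicities.
record Listing {A : Set a} (P : Pred A p) : Set (a ⊔ p) where
  field
    elements : List A
    unique   : Unique elements
    sound    : ∀ {x} → x ∈ elements → P x
    complete : ∀ {x} → P x → x ∈ elements

open Listing

∑ : {P : Pred A p} → Listing P → (A → ℚ) → ℚ
∑ L f = foldr ℚ._+_ 0ℚ (map f (elements L))

restrict : Listing P → Decidable Q → (∀ {x} → Q x → P x) → Listing Q
restrict L Q? Q⊆P = record
  { elements = filter Q? (elements L)
  ; unique   = Unique.filter⁺ Q? (unique L)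
  ; sound    = λ x∈ → proj₂ (∈-filter⁻ Q? {xs = elements L} x∈)
  ; complete = λ qx → ∈-filter⁺ Q? (complete L (Q⊆P qx)) qx
  }

product : Listing P → Listing Q → Listing (λ (x , y) → P x × Q y)
product L M = record
  { elements = cartesianProduct (elements L) (elements M)
  ; unique   = Unique.cartesianProduct⁺ (unique L) (unique M)
  ; sound    = λ xy∈ → let x∈ , y∈ = ∈-cartesianProduct⁻ (elements L) (elements M) xy∈
                       in sound L x∈ , sound M y∈
  ; complete = λ (px , qy) → ∈-cartesianProduct⁺ (complete L px) (complete M qy)
  }

finite⇒dec : Finite A → Dec A
finite⇒dec (zero  , A↔Fin) = no λ x → case Inverse.to A↔Fin x of λ ()
finite⇒dec (suc _ , A↔Fin) = yes (Inverse.from A↔Fin Fin.zero)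

inhabited⇒card-nonZero : (F : Finite A) → A → NonZero (card F)
inhabited⇒card-nonZero (zero  , A↔Fin) x = case Inverse.to A↔Fin x of λ ()
inhabited⇒card-nonZero (suc _ , _)     _ = _

-- Elements of ℚ[[t]] as coefficient sequences; equality is pointwise (_≗_).
PowerSeries : Set
PowerSeries = ℕ → ℚ

[t^_]_ : ℕ → PowerSeries → ℚ
[t^ n ] f = f n

-- Each power of t occurs finitely often among the t^(e i) with P i, so that
-- the series below is a well-defined formal sum.
FiniteFibres : {I : Set a} → Pred I p → (I → ℕ) → Set (a ⊔ p)
FiniteFibres P e = ∀ m → Listing (λ i → P i × e i ≡ m)

-- The formal sum of c i · t^(e i) over all i satisfying P.
series : {I : Set a} (P : Pred I p) (c : I → ℚ) (e : I → ℕ) → FiniteFibres P e → PowerSeries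
series P c e fibres m = ∑ (fibres m) c

ℕ-fibres : {P : Pred ℕ p} → Decidable P → (e : ℕ → ℕ) → (∀ {n} → P n → n ≤ e n) → FiniteFibres P e
ℕ-fibres P? e n≤en m = restrict below (λ n → P? n ×-dec (e n ≟ m)) λ (pn , en≡m) → subst (_ ≤_) en≡m (n≤en pn)
  where
  below : Listing (_≤ m)
  below = record
    { elements = upTo (suc m)
    ; unique   = Unique.upTo⁺ (suc m)
    ; sound    = λ n∈ → ℕ.≤-pred (∈-upTo⁻ n∈)
    ; complete = λ n≤m → ∈-upTo⁺ (s≤s n≤m)
    }

2n+1-fibres : FiniteFibres (_≥ 0) (λ n → 2 * n + 1)
2n+1-fibres = ℕ-fibres (_≥? 0) _ λ {n} _ → ℕ.≤-trans (ℕ.m≤m+n n _) (ℕ.m≤m+n (2 * n) 1)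

2n∸1-fibres : FiniteFibres (_≥ 1) (λ n → 2 * n ∸ 1)
2n∸1-fibres = ℕ-fibres (_≥? 1) _ n≤2n∸1
  where
  n≤2n∸1 : ∀ {n} → n ≥ 1 → n ≤ 2 * n ∸ 1
  n≤2n∸1 {suc n} _ = ℕ.≤-trans (ℕ.≤-reflexive (ℕ.+-comm 1 n)) (ℕ.+-monoʳ-≤ n (s≤s z≤n))

record SmallCategory o ℓ : Set (lsuc (o ⊔ ℓ)) where
  infixr 9 _∘_
  field
    Obj       : Set o
    Hom       : Obj → Obj → Set ℓ
    id        : ∀ {x} → Hom x x
    _∘_       : ∀ {x y z} → Hom y z → Hom x y → Hom x z
    assoc     : ∀ {w x y z} (h : Hom y z) (g : Hom x y) (f : Hom w x) → (h ∘ g) ∘ f ≡ h ∘ (g ∘ f)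
    identityˡ : ∀ {x y} (f : Hom x y) → id ∘ f ≡ f
    identityʳ : ∀ {x y} (f : Hom x y) → f ∘ id ≡ f

module _ {o ℓ} (𝒞 : SmallCategory o ℓ) (rank : SmallCategory.Obj 𝒞 → ℕ) where
  open SmallCategory 𝒞

  infixr 5 _∷⟨_⟩_

  data Chain : ℕ → Obj → Obj → Set (o ⊔ ℓ) where
    []      : ∀ {x} → Chain 0 x x
    _∷⟨_⟩_  : ∀ {k x y z} → Hom x y → rank y ≡ rank x + 1 → Chain k y z → Chain (suc k) x z

  composite : ∀ {k x y} → Chain k x y → Hom x y
  composite []             = id
  composite (f ∷⟨ _ ⟩ fs)  = composite fs ∘ f

record UpdownCategory o ℓ : Set (lsuc (o ⊔ ℓ)) where
  field
    category : SmallCategory o ℓ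

  open SmallCategory category public

  infix 8 _⁻¹

  field
    -- ℕ is a thin category, so functoriality of rank is monotonicity alone.
    rank          : Obj → ℕ
    rank-mono     : ∀ {x y} → Hom x y → rank x ≤ rank y

    rank-finite   : ∀ n → Finite (Σ[ x ∈ Obj ] rank x ≡ n)

    0̂             : Obj
    rank-0̂        : rank 0̂ ≡ 0
    0̂-unique      : ∀ x → rank x ≡ 0 → x ≡ 0̂
    from-0̂        : ∀ x → Hom 0̂ x

    Hom-finite    : ∀ x y → Finite (Hom x y)
    Hom-rank      : ∀ {x y} → Hom x y → rank x < rank y ⊎ x ≡ y
    _⁻¹           : ∀ {x} → Hom x x → Hom x x
    Aut-isGroup   : ∀ x → IsGroup _≡_ (_∘_ {x} {x} {x}) id _⁻¹

    -- For k = 0 there is nothing to factor; demanding that an automorphism be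
    -- the empty composite would force every Hom x x to be trivial.
    factorisation : ∀ {x y k} (f : Hom x y) → k ≥ 1 → rank y ≡ rank x + k →
                    Σ[ c ∈ Chain category rank k x y ] composite category rank c ≡ f

    free-source   : ∀ {x y} → rank y ≡ rank x + 1 → (f : Hom x y) (α : Hom x x) → f ∘ α ≡ f → α ≡ id
    free-target   : ∀ {x y} → rank y ≡ rank x + 1 → (f : Hom x y) (β : Hom y y) → β ∘ f ≡ f → β ≡ id

  #Hom : Obj → Obj → ℕ
  #Hom x y = card (Hom-finite x y)

  #Aut : Obj → ℕ
  #Aut x = #Hom x x

  instance
    #Aut-nonZero : ∀ {x} → NonZero (#Aut x)
    #Aut-nonZero {x} = inhabited⇒card-nonZero (Hom-finite x x) id

  -- Meaningful when rank y ≡ rank x + 1.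
  u : Obj → Obj → ℚ
  u x y = + #Hom x y / #Aut y

  d : Obj → Obj → ℚ
  d x y = + #Hom x y / #Aut x

  -- Finiteness of Hom x y makes inhabitedness decidable, so no truncation is
  -- needed to say that it is nonempty.
  infix 4 _⪯_ _≺_ _⋖_

  _⪯_ : Rel Obj ℓ
  x ⪯ y = Hom x y

  _≺_ : Rel Obj (o ⊔ ℓ)
  _≺_ = ToStrict._<_ _≡_ _⪯_

  _⋖_ : Rel Obj (o ⊔ ℓ)
  x ⋖ y = x ≺ y × (∀ z → x ≺ z → ¬ (z ≺ y))

  ≺⇒rank< : ∀ {x y} → x ≺ y → rank x < rank y
  ≺⇒rank< (f , x≢y) with Hom-rank f
  ... | inj₁ lt  = lt
  ... | inj₂ x≡y = ⊥-elim (x≢y x≡y)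

  rank<⇒≢ : ∀ {x y} → rank x < rank y → x ≢ y
  rank<⇒≢ lt refl = ℕ.<-irrefl refl lt

  rank-step : ∀ {x y} → rank y ≡ rank x + 1 → rank x < rank y
  rank-step {x} e = ℕ.≤-reflexive (trans (ℕ.+-comm 1 (rank x)) (sym e))

  ⋖⇒rank : ∀ {x y} → x ⋖ y → rank y ≡ rank x + 1
  ⋖⇒rank {x} {y} (x≺y , nothing-between) = go _ (sym gap)
    where
    gap : rank x + suc (rank y ∸ suc (rank x)) ≡ rank y
    gap = trans (ℕ.+-suc (rank x) _) (ℕ.m+[n∸m]≡n (≺⇒rank< x≺y))

    go : ∀ k → rank y ≡ rank x + suc k → rank y ≡ rank x + 1
    go zero    e = e
    go (suc k) e with factorisation (proj₁ x≺y) (s≤s z≤n) e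
    ... | _∷⟨_⟩_ {y = z} f e₁ (g ∷⟨ e₂ ⟩ gs) , _ =
      ⊥-elim $ nothing-between z
        (f , rank<⇒≢ (rank-step e₁))
        (composite category rank (g ∷⟨ e₂ ⟩ gs) ,
         rank<⇒≢ (ℕ.<-≤-trans (rank-step e₂) (rank-mono (composite category rank gs))))

  rank⇒⋖ : ∀ {x y} → Hom x y × rank y ≡ rank x + 1 → x ⋖ y
  rank⇒⋖ {x} {y} (f , e) = (f , rank<⇒≢ (rank-step e)) , λ z x≺z z≺y →
    ℕ.<-irrefl refl $ ℕ.<-≤-trans (≺⇒rank< z≺y) $
      ℕ.≤-trans (ℕ.≤-reflexive (trans e (ℕ.+-comm (rank x) 1))) (≺⇒rank< x≺z)

  _⋖?_ : ∀ x y → Dec (x ⋖ y)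
  x ⋖? y = map′ rank⇒⋖ (λ c → proj₁ (proj₁ c) , ⋖⇒rank c)
                (finite⇒dec (Hom-finite x y) ×-dec (rank y ≟ rank x + 1))

  ofRank : ∀ n → Listing (λ x → rank x ≡ n)
  ofRank n = record
    { elements = tabulate object
    ; unique   = Unique.tabulate⁺ object-injective
    ; sound    = λ x∈ → let i , x≡ = ∈-tabulate⁻ x∈ in trans (cong rank x≡) (proj₂ (from i))
    ; complete = λ {x} e → subst (_∈ tabulate object) (cong proj₁ (strictlyInverseʳ (x , e)))
                                 (∈-tabulate⁺ (to (x , e)))
    }
    where
    open Inverse (proj₂ (rank-finite n))

    object : Fin (card (rank-finite n)) → Obj
    object i = proj₁ (from i)

    Σ-≡ : {s t : Σ[ x ∈ Obj ] rank x ≡ n} → proj₁ s ≡ proj₁ t → s ≡ t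
    Σ-≡ {x , e} {.x , e′} refl = cong (x ,_) (≡-irrelevant e e′)

    object-injective : ∀ {i j} → object i ≡ object j → i ≡ j
    object-injective {i} {j} eq =
      trans (sym (strictlyInverseˡ i)) (trans (cong to (Σ-≡ eq)) (strictlyInverseˡ j))

  upToRank : ∀ n → Listing (λ x → rank x ≤ n)
  upToRank zero = restrict (ofRank 0) (λ x → rank x ℕ.≤? 0) ℕ.n≤0⇒n≡0
  upToRank (suc n) = record
    { elements = elements lower ++ elements top
    ; unique   = Unique.++⁺ (unique lower) (unique top) λ (x∈l , x∈t) →
                   ℕ.1+n≰n (subst (_≤ n) (sound top x∈t) (sound lower x∈l))
    ; sound    = λ x∈ → case ∈-++⁻ (elements lower) x∈ of λ where
                   (inj₁ x∈l) → ℕ.m≤n⇒m≤1+n (sound lower x∈l)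
                   (inj₂ x∈t) → ℕ.≤-reflexive (sound top x∈t)
    ; complete = λ le → case ℕ.m≤n⇒m<n∨m≡n le of λ where
                   (inj₁ lt) → ∈-++⁺ˡ (complete lower (ℕ.≤-pred lt))
                   (inj₂ eq) → ∈-++⁺ʳ (elements lower) (complete top eq)
    }
    where
    lower = upToRank n
    top   = ofRank (suc n)

  upCovers : ∀ x → Listing (λ y → x ⋖ y)
  upCovers x = restrict (upToRank (rank x + 1)) (x ⋖?_) λ c → ℕ.≤-reflexive (⋖⇒rank c)

  downCovers : ∀ x → Listing (λ y → y ⋖ x)
  downCovers x = restrict (upToRank (rank x)) (_⋖? x) λ c → rank-mono (proj₁ (proj₁ c))

  -- The sequences take values in ℚ, like u and d; the entry 0 of the
  -- down-covering sequence is a dummy.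
  EvenlyUpCovered : (ℕ → ℚ) → Set o
  EvenlyUpCovered us = ∀ n x → rank x ≡ n → ∑ (upCovers x) (λ y → u x y) ≡ us n

  EvenlyDownCovered : (ℕ → ℚ) → Set o
  EvenlyDownCovered ds = ∀ n → n ≥ 1 → ∀ x → rank x ≡ n → ∑ (downCovers x) (λ y → d y x) ≡ ds n

  Obj-fibres : FiniteFibres U rank
  Obj-fibres m = restrict (ofRank m) (λ x → yes tt ×-dec (rank x ≟ m)) proj₂

  ⋖-fibres : FiniteFibres (uncurry _⋖_) (λ (x , y) → rank x + rank y)
  ⋖-fibres m = restrict (product (upToRank m) (upToRank m))
    (λ (x , y) → (x ⋖? y) ×-dec (rank x + rank y ≟ m))
    λ {(x , y)} (_ , e) → subst (rank x ≤_) e (ℕ.m≤m+n _ _) , subst (rank y ≤_) e (ℕ.m≤n+m _ _)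

  objectGF : PowerSeries
  objectGF = series U (λ x → 1ℤ / #Aut x) rank Obj-fibres

  morphismGF : PowerSeries
  morphismGF = series (uncurry _⋖_) (λ (x , y) → u x y ℚ.* (1ℤ / #Aut x))
                      (λ (x , y) → rank x + rank y) ⋖-fibres

{-# OPTIONS --safe #-}

-- Each covering pair p ⋖ q has |q| = |p| + 1, hence contributes to degree
-- 2|p| + 1 = 2|q| ∸ 1.  Grouping the pairs by n = |p|, then by p ∈ 𝒞ₙ, the
-- inner sum over q is uₙ / |Aut p| and the sum over p is aₙ uₙ.  For the second
-- part group by q instead, using u(p;q) / |Aut p| = d(p;q) / |Aut q|.
module Submission where

open import Defs
open Listing
open import Data.Integer.Base as ℤ using (1ℤ)
open import Data.List.Base using (List; []; _∷_; _++_; foldr; map; concatMap)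
open import Data.List.Membership.Propositional using (_∈_; find; lose)
open import Data.List.Membership.Propositional.Properties
  using (∈-map⁺; ∈-map⁻; ∈-concatMap⁺; ∈-concatMap⁻)
open import Data.List.Membership.Propositional.Properties.WithK using (unique∧set⇒bag)
open import Data.List.Properties using (map-∘; map-++)
open import Data.List.Relation.Binary.BagAndSetEquality using (∼bag⇒↭)
open import Data.List.Relation.Binary.Permutation.Propositional using (_↭_; ↭⇒↭ₛ)
open import Data.List.Relation.Binary.Permutation.Propositional.Properties using (map⁺)
open import Data.List.Relation.Binary.Permutation.Setoid.Properties using (foldr-commMonoid)
import Data.List.Relation.Unary.All as All
import Data.List.Relation.Unary.All.Properties as All
import Data.List.Relation.Unary.AllPairs as AllPairs
import Data.List.Relation.Unary.AllPairs.Properties as AllPairs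
open import Data.List.Relation.Unary.Any using (here; there)
import Data.List.Relation.Unary.Unique.Propositional.Properties as Unique
open import Data.Nat.Base using (ℕ; suc; _+_; _*_; _∸_; _≥_; NonZero; z≤n)
import Data.Nat.Properties as ℕ
import Data.Nat.Solver as ℕ
open import Data.Product.Base using (_×_; _,_; proj₁; proj₂; ∃)
open import Data.Rational.Base as ℚ using (ℚ; 0ℚ; _/_; fromℚᵘ)
import Data.Rational.Properties as ℚ
open import Data.Rational.Unnormalised.Base as ℚᵘ using (mkℚᵘ)
import Data.Rational.Unnormalised.Properties as ℚᵘ
open import Data.Unit.Base using (tt)
open import Function.Base using (_∘_; _$_)
open import Function.Bundles using (mk⇔)
open import Function.Definitions using (Injective)
open import Level using (Level)
open import Relation.Binary.PropositionalEquality
  using (_≡_; _≗_; refl; sym; trans; cong; cong₂; subst; setoid; module ≡-Reasoning)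
open import Relation.Unary using (Pred)

private
  variable
    a b p : Level
    A : Set a
    B : Set b
    P : Pred A p

sum : List ℚ → ℚ
sum = foldr ℚ._+_ 0ℚ

sum-↭ : ∀ {xs ys} → xs ↭ ys → sum xs ≡ sum ys
sum-↭ xs↭ys = foldr-commMonoid (setoid ℚ) ℚ.+-0-isCommutativeMonoid (↭⇒↭ₛ xs↭ys)

sum-++ : ∀ xs ys → sum (xs ++ ys) ≡ sum xs ℚ.+ sum ys
sum-++ []       ys = sym (ℚ.+-identityˡ _)
sum-++ (x ∷ xs) ys = trans (cong (x ℚ.+_) (sum-++ xs ys)) (sym (ℚ.+-assoc x (sum xs) (sum ys)))

sum-map-cong : ∀ {f g : A → ℚ} xs → (∀ {x} → x ∈ xs → f x ≡ g x) → sum (map f xs) ≡ sum (map g xs)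
sum-map-cong []       f≡g = refl
sum-map-cong (x ∷ xs) f≡g = cong₂ ℚ._+_ (f≡g (here refl)) (sum-map-cong xs (f≡g ∘ there))

sum-map-*ʳ : ∀ (f : A → ℚ) c xs → sum (map (λ x → f x ℚ.* c) xs) ≡ sum (map f xs) ℚ.* c
sum-map-*ʳ f c []       = sym (ℚ.*-zeroˡ c)
sum-map-*ʳ f c (x ∷ xs) =
  trans (cong (f x ℚ.* c ℚ.+_) (sum-map-*ʳ f c xs)) (sym (ℚ.*-distribʳ-+ c (f x) (sum (map f xs))))

sum-concatMap : ∀ (f : B → ℚ) (g : A → List B) xs →
                sum (map f (concatMap g xs)) ≡ sum (map (λ x → sum (map f (g x))) xs)
sum-concatMap f g []       = refl
sum-concatMap f g (x ∷ xs) = begin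
  sum (map f (g x ++ concatMap g xs))                     ≡⟨ cong sum (map-++ f (g x) (concatMap g xs)) ⟩
  sum (map f (g x) ++ map f (concatMap g xs))             ≡⟨ sum-++ (map f (g x)) _ ⟩
  sum (map f (g x)) ℚ.+ sum (map f (concatMap g xs))      ≡⟨ cong (sum (map f (g x)) ℚ.+_) (sum-concatMap f g xs) ⟩
  sum (map (λ y → sum (map f (g y))) (x ∷ xs))            ∎
  where open ≡-Reasoning

-- Agreement is asked only where `P` holds, and `sound` supplies that proof for each listed element.
-- This makes `rank x ≡ n` available under a sum over `Obj-fibres n`.
∑-cong : ∀ (L : Listing P) {f g : A → ℚ} → (∀ {x} → P x → f x ≡ g x) → ∑ L f ≡ ∑ L g
∑-cong L f≡g = sum-map-cong (elements L) (f≡g ∘ sound L)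

∑-*ʳ : ∀ (L : Listing P) f c → ∑ L (λ x → f x ℚ.* c) ≡ ∑ L f ℚ.* c
∑-*ʳ L f c = sum-map-*ʳ f c (elements L)

-- Injectivity of `h` keeps the image list duplicate-free, and the two transfer conditions give it
-- the same members as the list of `M`. Duplicate-free lists with the same members are permutations
-- of each other, and rational addition is commutative.
∑-reindex : ∀ {q} {P : Pred A p} {Q : Pred B q} (L : Listing P) (M : Listing Q) (h : A → B) →
            Injective _≡_ _≡_ h →
            (∀ {x} → P x → Q (h x)) →
            (∀ {y} → Q y → ∃ λ x → P x × y ≡ h x) →
            ∀ f → ∑ L (f ∘ h) ≡ ∑ M f
∑-reindex L M h h-inj P⇒Q Q⇒P f = begin
  sum (map (f ∘ h) (elements L))      ≡⟨ cong sum (map-∘ (elements L)) ⟩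
  sum (map f (map h (elements L)))    ≡⟨ sum-↭ (map⁺ f images↭) ⟩
  sum (map f (elements M))            ∎
  where
  open ≡-Reasoning

  image⊆ : ∀ {y} → y ∈ map h (elements L) → y ∈ elements M
  image⊆ y∈ with x , x∈ , refl ← ∈-map⁻ h y∈ = complete M (P⇒Q (sound L x∈))

  ⊆image : ∀ {y} → y ∈ elements M → y ∈ map h (elements L)
  ⊆image y∈ with x , px , refl ← Q⇒P (sound M y∈) = ∈-map⁺ h (complete L px)

  images↭ : map h (elements L) ↭ elements M
  images↭ = ∼bag⇒↭ $ unique∧set⇒bag (Unique.map⁺ h-inj (unique L)) (unique M) (mk⇔ image⊆ ⊆image)

-- Dependent analogue of `product`: the second listing may vary with the first component. Grouping
-- covering pairs by rank and then by object is two nested uses of it.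
total : ∀ {q} {P : Pred A p} {Q : A → Pred B q} → Listing P → (∀ x → Listing (Q x)) →
        Listing (λ (x , y) → P x × Q x y)
total {A = A} {B = B} L M = record
  { elements = concatMap row (elements L)
  ; unique   = Unique.concat⁺
      (All.map⁺ (All.universal (λ x → Unique.map⁺ (cong proj₂) (unique (M x))) (elements L)))
      -- Rows over distinct objects are disjoint, because the first component of a pair determines
      -- its row.
      (AllPairs.map⁺ (AllPairs.map
        (λ x≢y {_} (v∈x , v∈y) → x≢y (trans (sym (row-proj₁ v∈x)) (row-proj₁ v∈y))) (unique L)))
  ; sound    = λ v∈ → sound′ (find (∈-concatMap⁻ row v∈))
  ; complete = λ {(x , y)} (px , qxy) →
      ∈-concatMap⁺ row (lose (complete L px) (∈-map⁺ (x ,_) (complete (M x) qxy)))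
  }
  where
  row : A → List (A × B)
  row x = map (x ,_) (elements (M x))

  row-proj₁ : ∀ {x v} → v ∈ row x → proj₁ v ≡ x
  row-proj₁ v∈ with _ , _ , refl ← ∈-map⁻ _ v∈ = refl

  sound′ : ∀ {v} → (∃ λ x → x ∈ elements L × v ∈ row x) → _
  sound′ (x , x∈ , v∈) with _ , y∈ , refl ← ∈-map⁻ _ v∈ = sound L x∈ , sound (M x) y∈

-- The list is a concatenation of rows, so the sum splits along them without any reordering.
∑-total : ∀ {q} {P : Pred A p} {Q : A → Pred B q} (L : Listing P) (M : ∀ x → Listing (Q x)) f →
          ∑ (total L M) f ≡ ∑ L (λ x → ∑ (M x) (λ y → f (x , y)))
∑-total L M f = trans
  (sum-concatMap f (λ x → map (x ,_) (elements (M x))) (elements L))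
  (sum-map-cong (elements L) λ {x} _ → cong sum (sym (map-∘ (elements (M x)))))

-- Reduction to lowest terms is invisible up to equivalence of unnormalised fractions, so the
-- equation is checked there, through the injectivity of `toℚᵘ`.
fromℚᵘ-homo-* : ∀ r s → fromℚᵘ (r ℚᵘ.* s) ≡ fromℚᵘ r ℚ.* fromℚᵘ s
fromℚᵘ-homo-* r s = ℚ.toℚᵘ-injective $ begin
  ℚ.toℚᵘ (fromℚᵘ (r ℚᵘ.* s))                  ≈⟨ ℚ.toℚᵘ-fromℚᵘ (r ℚᵘ.* s) ⟩
  r ℚᵘ.* s                                    ≈⟨ ℚᵘ.*-cong (ℚ.toℚᵘ-fromℚᵘ r) (ℚ.toℚᵘ-fromℚᵘ s) ⟨
  ℚ.toℚᵘ (fromℚᵘ r) ℚᵘ.* ℚ.toℚᵘ (fromℚᵘ s)    ≈⟨ ℚ.toℚᵘ-homo-* (fromℚᵘ r) (fromℚᵘ s) ⟨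
  ℚ.toℚᵘ (fromℚᵘ r ℚ.* fromℚᵘ s)              ∎
  where open ℚᵘ.≃-Reasoning

/-*-1/-comm : ∀ i m n .{{_ : NonZero m}} .{{_ : NonZero n}} →
              (i / m) ℚ.* (1ℤ / n) ≡ (i / n) ℚ.* (1ℤ / m)
/-*-1/-comm i m@(suc k) n@(suc l) = begin
  (i / m) ℚ.* (1ℤ / n)                     ≡⟨ fromℚᵘ-homo-* (mkℚᵘ i k) (mkℚᵘ 1ℤ l) ⟨
  -- Before reduction both products have numerator `i ℤ.* 1ℤ`; only the order of the factors in the
  -- denominator differs.
  fromℚᵘ (mkℚᵘ i k ℚᵘ.* mkℚᵘ 1ℤ l)         ≡⟨ ℚ./-cong {p₁ = i ℤ.* 1ℤ} refl (ℕ.*-comm m n) ⟩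
  fromℚᵘ (mkℚᵘ i l ℚᵘ.* mkℚᵘ 1ℤ k)         ≡⟨ fromℚᵘ-homo-* (mkℚᵘ i l) (mkℚᵘ 1ℤ k) ⟩
  (i / n) ℚ.* (1ℤ / m)                     ∎
  where open ≡-Reasoning

r+[r+1]≡2r+1 : ∀ r → r + (r + 1) ≡ 2 * r + 1
r+[r+1]≡2r+1 = solve 1 (λ r → r :+ (r :+ con 1) := con 2 :* r :+ con 1) refl
  where open ℕ.+-*-Solver

r+[r+1]≡2[r+1]∸1 : ∀ r → r + (r + 1) ≡ 2 * (r + 1) ∸ 1
-- The solver is given the identity with 1 added to both sides, free of truncated subtraction;
-- `suc k ∸ 1` then computes to `k` on the left.
r+[r+1]≡2[r+1]∸1 r = cong (_∸ 1) $
  solve 1 (λ r → con 1 :+ (r :+ (r :+ con 1)) := con 2 :* (r :+ con 1)) refl r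
  where open ℕ.+-*-Solver

module _ {o ℓ} (C : UpdownCategory o ℓ) where
  open UpdownCategory C hiding (_∘_)

  -- Both sides are `#Hom x y` divided by the product of `#Aut x` and `#Aut y`.
  u/#Aut≡d/#Aut : ∀ x y → u x y ℚ.* (1ℤ / #Aut x) ≡ d x y ℚ.* (1ℤ / #Aut y)
  u/#Aut≡d/#Aut x y = /-*-1/-comm (ℤ.+ #Hom x y) (#Aut y) (#Aut x)

  -- The factor `1ℤ / #Aut x` is constant in the inner sum, which is then `c` for every `x` of rank
  -- `n`; what remains is the defining sum of the coefficient. Abstract `covers` and `w` let `x` be
  -- the lower object (with `u`) or the upper one (with `d` flipped).
  objectGF-weighted :
    ∀ {r} {R : Obj → Pred Obj r} (covers : ∀ x → Listing (R x)) (w : Obj → Obj → ℚ) c n →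
    (∀ x → rank x ≡ n → ∑ (covers x) (w x) ≡ c) →
    ∑ (total (Obj-fibres n) covers) (λ (x , y) → w x y ℚ.* (1ℤ / #Aut x)) ≡ [t^ n ] objectGF ℚ.* c
  objectGF-weighted covers w c n ∑w≡c = begin
    ∑ (total (Obj-fibres n) covers) (λ (x , y) → w x y ℚ.* (1ℤ / #Aut x))
      ≡⟨ ∑-total (Obj-fibres n) covers _ ⟩
    ∑ (Obj-fibres n) (λ x → ∑ (covers x) (λ y → w x y ℚ.* (1ℤ / #Aut x)))
      ≡⟨ ∑-cong (Obj-fibres n) (λ {x} (_ , rx≡n) →
           trans (∑-*ʳ (covers x) (w x) _)
          (trans (cong (ℚ._* (1ℤ / #Aut x)) (∑w≡c x rx≡n)) (ℚ.*-comm c _))) ⟩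
    ∑ (Obj-fibres n) (λ x → (1ℤ / #Aut x) ℚ.* c)
      ≡⟨ ∑-*ʳ (Obj-fibres n) _ c ⟩
    [t^ n ] objectGF ℚ.* c ∎
    where open ≡-Reasoning

  -- Evenness is asked only for `n` satisfying `P`, because down-coveredness constrains only ranks
  -- `n ≥ 1`.
  ∑-coverings :
    ∀ {p r} {P : Pred ℕ p} {R : Obj → Pred Obj r} (K : Listing P) (covers : ∀ x → Listing (R x)) w
    (cs : ℕ → ℚ) → (∀ {n} → P n → ∀ x → rank x ≡ n → ∑ (covers x) (w x) ≡ cs n) →
    ∑ (total K (λ n → total (Obj-fibres n) covers)) (λ (_ , x , y) → w x y ℚ.* (1ℤ / #Aut x)) ≡
    ∑ K (λ n → [t^ n ] objectGF ℚ.* cs n)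
  ∑-coverings K covers w cs even = trans
    (∑-total K (λ n → total (Obj-fibres n) covers) _)
    (∑-cong K λ {n} pn → objectGF-weighted covers w (cs n) n (even pn))

  morphismGF-up : (us : ℕ → ℚ) → EvenlyUpCovered us →
    morphismGF ≗ series (_≥ 0) (λ n → [t^ n ] objectGF ℚ.* us n) (λ n → 2 * n + 1) 2n+1-fibres
  morphismGF-up us even m = trans
    (∑-reindex (⋖-fibres m) (total (2n+1-fibres m) (λ n → total (Obj-fibres n) upCovers))
      -- Each pair is tagged with the rank of its lower object; the tag loses nothing, so
      -- injectivity is projection.
      (λ (x , y) → rank x , x , y) (cong proj₂)
      (λ (x⋖y , e) → (z≤n , trans (sym (degree x⋖y)) e) , (tt , refl) , x⋖y)
      -- Matching the proof of `rank x ≡ n` with `refl` forces the tag to be `rank x`, so every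
      -- triple comes from a pair.
      (λ { {_ , x , y} ((_ , e) , (_ , refl) , x⋖y) → (x , y) , (x⋖y , trans (degree x⋖y) e) , refl })
      (λ (_ , x , y) → u x y ℚ.* (1ℤ / #Aut x)))
    (∑-coverings (2n+1-fibres m) upCovers u us λ _ → even _)
    where
    degree : ∀ {x y} → x ⋖ y → rank x + rank y ≡ 2 * rank x + 1
    degree {x} x⋖y = trans (cong (rank x +_) (⋖⇒rank x⋖y)) (r+[r+1]≡2r+1 (rank x))

  morphismGF-down : (ds : ℕ → ℚ) → EvenlyDownCovered ds →
    morphismGF ≗ series (_≥ 1) (λ n → [t^ n ] objectGF ℚ.* ds n) (λ n → 2 * n ∸ 1) 2n∸1-fibres
  morphismGF-down ds even m = begin
    ∑ (⋖-fibres m) (λ (x , y) → u x y ℚ.* (1ℤ / #Aut x))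
      ≡⟨ ∑-cong (⋖-fibres m) (λ {(x , y)} _ → u/#Aut≡d/#Aut x y) ⟩
    ∑ (⋖-fibres m) (λ (x , y) → d x y ℚ.* (1ℤ / #Aut y))
      ≡⟨ ∑-reindex (⋖-fibres m) (total (2n∸1-fibres m) (λ n → total (Obj-fibres n) downCovers))
           -- The upper object now comes first, since `downCovers` fixes it and lists the objects
           -- below.
           (λ (x , y) → rank y , y , x) (λ { refl → refl })
           (λ (x⋖y , e) → (positive x⋖y , trans (sym (degree x⋖y)) e) , (tt , refl) , x⋖y)
           (λ { {_ , y , x} ((_ , e) , (_ , refl) , x⋖y) → (x , y) , (x⋖y , trans (degree x⋖y) e) , refl })
           (λ (_ , y , x) → d x y ℚ.* (1ℤ / #Aut y)) ⟩
    ∑ (total (2n∸1-fibres m) (λ n → total (Obj-fibres n) downCovers)) (λ (_ , y , x) → d x y ℚ.* (1ℤ / #Aut y))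
      ≡⟨ ∑-coverings (2n∸1-fibres m) downCovers (λ y x → d x y) ds (λ (n≥1 , _) → even _ n≥1) ⟩
    ∑ (2n∸1-fibres m) (λ n → [t^ n ] objectGF ℚ.* ds n) ∎
    where
    open ≡-Reasoning

    -- Places the index `rank y` in the range of the target series, which starts at `n = 1`.
    positive : ∀ {x y} → x ⋖ y → rank y ≥ 1
    positive {x} x⋖y = subst (_≥ 1) (sym (⋖⇒rank x⋖y)) (ℕ.m≤n+m 1 (rank x))

    degree : ∀ {x y} → x ⋖ y → rank x + rank y ≡ 2 * rank y ∸ 1
    degree {x} x⋖y rewrite ⋖⇒rank x⋖y = r+[r+1]≡2[r+1]∸1 (rank x)

theorem3p4 : ∀ {o ℓ} (C : UpdownCategory o ℓ) →
    let open UpdownCategory C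
        a = λ n → [t^ n ] objectGF
    in
      ((us : ℕ → ℚ) → EvenlyUpCovered us →
        morphismGF ≗ series (_≥ 0) (λ n → a n ℚ.* us n) (λ n → 2 * n + 1) 2n+1-fibres)
      ×
      ((ds : ℕ → ℚ) → EvenlyDownCovered ds →
        morphismGF ≗ series (_≥ 1) (λ n → a n ℚ.* ds n) (λ n → 2 * n ∸ 1) 2n∸1-fibres)
theorem3p4 C = morphismGF-up C , morphismGF-down C
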